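{- Let $G$ be a graph with $|E(G)|\ge |V(G)|$. If $G$ is a super edge-magic graph of girth $g(G)\ge 4$, then $3+|E(G)|+|V(G)|$ is not the valence of any super edge-magic labeling of $G$.
   Context: Graphs are finite and simple. The notation $[a,b]$ denotes the set of integers $x$ with $a\le x\le b$. An edge-magic labeling of a graph $G$ is a bijection $f:V(G)\cup E(G)\to[1,|V(G)|+|E(G)|]$ such that $f(u)+f(v)+f(uv)$ equals a constant (the valence $\mathrm{val}(f)$ of $f$) for every $uv\in E(G)$. It is super edge-magic if moreover $f(V(G))=[1,|V(G)|]$, and $G$ is super edge-magic if it admits a super edge-magic labeling. The girth of a graph is the length of its shortest cycle. -}

module Defs where

open import Data.Fin.Base using (Fin; zero; suc; inject₁; fromℕ; _<_)
open import Data.Fin.Properties using (_<?_)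
open import Data.List.Base using (List; length; filter; allFin; cartesianProduct)
open import Data.Nat.Base using (ℕ; suc; _+_; _≤_)
open import Data.Product.Base using (Σ; ∃; _×_; _,_; proj₁; proj₂)
open import Data.Sum.Base using (_⊎_; inj₁; inj₂)
open import Function.Bundles using (_⤖_; _⇔_; Bijection)
open import Function.Definitions using (Injective)
open import Level using (0ℓ)
open import Relation.Binary.Core using (Rel)
open import Relation.Binary.Definitions using (Decidable; Symmetric; Irreflexive)
open import Relation.Binary.PropositionalEquality using (_≡_)
open import Relation.Nullary.Decidable using (_×-dec_)

record Graph : Set₁ where
  field
    order  : ℕ
    Adj    : Rel (Fin order) 0ℓ
    adj?   : Decidable Adj
    sym    : Symmetric Adj
    irrefl : Irreflexive _≡_ Adj

  Vertex : Set
  Vertex = Fin order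

  -- An edge is an unordered pair of adjacent vertices, represented by its
  -- increasing ordering.  The proofs are irrelevant, so an edge is determined
  -- by its two ends.
  record Edge : Set where
    constructor edge
    field
      end₁ end₂ : Vertex
      .ordered  : end₁ < end₂
      .adjacent : Adj end₁ end₂

  size : ℕ
  size = length (filter (λ (u , v) → (u <? v) ×-dec adj? u v)
                        (cartesianProduct (allFin order) (allFin order)))

  -- The closed walk v₀ , v₁ , … , vₘ , v₀ with v₀ , … , vₘ distinct.  In a
  -- simple graph a cycle has at least three vertices.
  record Cycle : Set where
    field
      m         : ℕ
      2≤m       : 2 ≤ m
      vertex    : Fin (suc m) → Vertex
      injective : Injective _≡_ _≡_ vertex
      step      : (i : Fin m) → Adj (vertex (inject₁ i)) (vertex (suc i))
      close     : Adj (vertex (fromℕ m)) (vertex zero)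

    cycleLength : ℕ
    cycleLength = suc m

  -- A relation rather than a function, since an acyclic graph has no shortest cycle.
  IsGirth : ℕ → Set
  IsGirth g = (Σ Cycle λ c → Cycle.cycleLength c ≡ g)
            × ((c : Cycle) → g ≤ Cycle.cycleLength c)

[_,_] : ℕ → ℕ → Set
[ a , b ] = ∃ λ x → a ≤ x × x ≤ b

module _ (G : Graph) where
  open Graph G

  record EdgeMagicLabeling : Set where
    field
      labeling : (Vertex ⊎ Edge) ⤖ [ 1 , order + size ]

    label : Vertex ⊎ Edge → ℕ
    label x = proj₁ (Bijection.to labeling x)

    field
      valence : ℕ
      magic   : (e : Edge) →
                label (inj₁ (Edge.end₁ e)) + label (inj₁ (Edge.end₂ e)) + label (inj₂ e)
                  ≡ valence

  IsSuper : EdgeMagicLabeling → Set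
  IsSuper f = (x : ℕ) →
    (∃ λ (v : Vertex) → EdgeMagicLabeling.label f (inj₁ v) ≡ x) ⇔ (1 ≤ x × x ≤ order)

  SuperEdgeMagicLabeling : Set
  SuperEdgeMagicLabeling = Σ EdgeMagicLabeling IsSuper

  val : SuperEdgeMagicLabeling → ℕ
  val f = EdgeMagicLabeling.valence (proj₁ f)

  SuperEdgeMagic : Set
  SuperEdgeMagic = SuperEdgeMagicLabeling

{-# OPTIONS --safe #-}
-- The edge labels fill the interval above the vertex labels, so with valence
-- 3 + |E| + |V| the sums f(u) + f(v) over edges uv are exactly 3 , … , |E| + 2.
-- Let c be the vertex labelled 1.  If c is adjacent to the vertices labelled
-- 2 , … , n - 1, then an edge of sum n + 1 avoiding c would close a triangle
-- with c, so the edge joins c to a vertex labelled n.  For n = |V| + 1 there is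
-- no such vertex, although |E| ≥ |V| provides an edge of sum |V| + 2.
module Submission where

open import Defs
open import Data.Empty using (⊥)
open import Data.Fin.Base using (Fin; zero; suc)
open import Data.Fin.Properties using (nonZeroIndex)
open import Data.Nat.Base using (ℕ; suc; _+_; _∸_; _≤_; _<_; _≥_; z≤n; s≤s; s≤s⁻¹; >-nonZero⁻¹)
open import Data.Nat.Induction using (<-rec)
open import Data.Nat.Properties
open import Data.Product.Base using (∃; _×_; _,_; proj₁; proj₂)
open import Data.Sum.Base using (inj₁; inj₂)
open import Data.Sum.Properties using (inj₁-injective)
open import Function.Bundles using (Bijection; Equivalence)
open import Function.Definitions using (Injective)
open import Relation.Binary.PropositionalEquality
  using (_≡_; refl; sym; trans; cong; cong₂; subst; module ≡-Reasoning)
open import Relation.Nullary.Decidable using (yes; no; recompute)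
open import Relation.Nullary.Negation.Core using (¬_; contradiction)

module _ (G : Graph) where
  open Graph G renaming (sym to Adj-sym)

  -- The three vertices are pairwise adjacent, so irreflexivity alone makes them distinct.
  triangle : ∀ {u v w} → Adj u v → Adj v w → Adj w u → Cycle
  triangle {u} {v} {w} uv vw wu = record
    { m         = 2
    ; 2≤m       = ≤-refl
    ; vertex    = vertex
    ; injective = injective
    ; step      = λ { zero → uv ; (suc zero) → vw }
    ; close     = wu
    }
    where
    vertex : Fin 3 → Vertex
    vertex zero             = u
    vertex (suc zero)       = v
    vertex (suc (suc zero)) = w

    injective : Injective _≡_ _≡_ vertex
    injective {zero}           {zero}           _  = refl
    injective {zero}           {suc zero}       eq = contradiction uv (irrefl eq)
    injective {zero}           {suc (suc zero)} eq = contradiction wu (irrefl (sym eq))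
    injective {suc zero}       {zero}           eq = contradiction uv (irrefl (sym eq))
    injective {suc zero}       {suc zero}       _  = refl
    injective {suc zero}       {suc (suc zero)} eq = contradiction vw (irrefl eq)
    injective {suc (suc zero)} {zero}           eq = contradiction wu (irrefl eq)
    injective {suc (suc zero)} {suc zero}       eq = contradiction vw (irrefl (sym eq))
    injective {suc (suc zero)} {suc (suc zero)} _  = refl

  girth≥4⇒triangleFree : ∀ {g} → IsGirth g → g ≥ 4 →
                         ∀ {u v w} → Adj u v → Adj v w → Adj w u → ⊥
  girth≥4⇒triangleFree (_ , minimal) g≥4 uv vw wu =
    <⇒≱ g≥4 (minimal (triangle uv vw wu))

  -- Ensures that 1 is a vertex label; the cycle attaining the girth supplies a vertex.
  IsGirth⇒order>0 : ∀ {g} → IsGirth g → 1 ≤ order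
  IsGirth⇒order>0 ((c , _) , _) = >-nonZero⁻¹ order {{nonZeroIndex (Cycle.vertex c zero)}}

  -- An `Edge` stores its adjacency proof irrelevantly; decidability of `Adj` makes it usable again.
  end-adjacent : (e : Edge) → Adj (Edge.end₁ e) (Edge.end₂ e)
  end-adjacent (edge u v _ uv) = recompute (adj? u v) uv

  module _ (f : EdgeMagicLabeling G) (super : IsSuper G f) where
    open EdgeMagicLabeling f

    vertexLabel : Vertex → ℕ
    vertexLabel v = label (inj₁ v)

    vertexLabel-bounds : ∀ v → 1 ≤ vertexLabel v × vertexLabel v ≤ order
    vertexLabel-bounds v = Equivalence.to (super _) (v , refl)

    []-≡ : ∀ {a b} {x y : [ a , b ]} → proj₁ x ≡ proj₁ y → x ≡ y
    []-≡ {x = x , p , q} {y = .x , p′ , q′} refl =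
      cong₂ (λ r s → x , r , s) (≤-irrelevant p p′) (≤-irrelevant q q′)

    vertexLabel-injective : Injective _≡_ _≡_ vertexLabel
    vertexLabel-injective eq = inj₁-injective (Bijection.injective labeling ([]-≡ eq))

    -- Surjectivity gives a preimage of `l`, and it is no vertex because super labelings keep vertex
    -- labels at most `order`.
    label-edge : ∀ {l} → order < l → l ≤ order + size → ∃ λ (e : Edge) → label (inj₂ e) ≡ l
    label-edge {l} p<l l≤p+q
      with Bijection.strictlySurjective labeling (l , ≤-trans (s≤s z≤n) p<l , l≤p+q)
    ... | inj₂ e , eq = e , cong proj₁ eq
    ... | inj₁ v , eq =
      contradiction (subst (_≤ order) (cong proj₁ eq) (proj₂ (vertexLabel-bounds v))) (<⇒≱ p<l)

    module _ (valence≡ : valence ≡ 3 + size + order) where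

      -- The sum is written `suc n` so that, when one end is labelled 1, the other is labelled `n`.
      edge-of-sum : ∀ {n} → 2 ≤ n → n ≤ suc size →
                    ∃ λ u → ∃ λ v → Adj u v × vertexLabel u + vertexLabel v ≡ suc n
      edge-of-sum {suc n} (s≤s 1≤n) (s≤s n≤q) =
        Edge.end₁ e , Edge.end₂ e , end-adjacent e , +-cancelʳ-≡ l _ _ sum+l
        where
        l : ℕ
        -- After matching, the wanted sum is `n + 2`, so this is the label left for the edge:
        -- `3 + size + order` minus `n + 2`.
        l = suc (order + (size ∸ n))

        l≤p+q : l ≤ order + size
        -- Since `1 ≤ n`, `size ∸ n` is strictly below `size`, which absorbs the successor in `l`.
        l≤p+q = ≤-trans (≤-reflexive (sym (+-suc order _)))
                        (+-monoʳ-≤ order (∸-monoʳ-< 1≤n n≤q))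

        edge-labelled-l : ∃ λ (e : Edge) → label (inj₂ e) ≡ l
        edge-labelled-l = label-edge (s≤s (m≤m+n order _)) l≤p+q

        e : Edge
        e = proj₁ edge-labelled-l

        open ≡-Reasoning

        sum+l : vertexLabel (Edge.end₁ e) + vertexLabel (Edge.end₂ e) + l ≡ suc (suc n) + l
        sum+l = begin
          vertexLabel (Edge.end₁ e) + vertexLabel (Edge.end₂ e) + l
            ≡⟨ cong (vertexLabel (Edge.end₁ e) + vertexLabel (Edge.end₂ e) +_) (proj₂ edge-labelled-l) ⟨
          vertexLabel (Edge.end₁ e) + vertexLabel (Edge.end₂ e) + label (inj₂ e)
            ≡⟨ magic e ⟩
          valence
            ≡⟨ valence≡ ⟩
          3 + (size + order)
            ≡⟨ cong (λ q → 3 + (q + order)) (m+[n∸m]≡n n≤q) ⟨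
          3 + (n + (size ∸ n) + order)
            ≡⟨ cong (3 +_) (+-assoc n _ order) ⟩
          3 + (n + (size ∸ n + order))
            ≡⟨ cong (λ k → 3 + (n + k)) (+-comm _ order) ⟩
          3 + (n + (order + (size ∸ n)))
            ≡⟨ cong (2 +_) (+-suc n _) ⟨
          suc (suc n) + l ∎

      module _ (triangleFree : ∀ {u v w} → Adj u v → Adj v w → Adj w u → ⊥)
               {c : Vertex} (c≡1 : vertexLabel c ≡ 1) where

        AdjacentLabel : ℕ → Set
        AdjacentLabel n = ∃ λ v → Adj c v × vertexLabel v ≡ n

        other-end-label : ∀ {u v n} → vertexLabel u ≡ 1 → vertexLabel u + vertexLabel v ≡ suc n →
                          vertexLabel v ≡ n
        other-end-label {v = v} u≡1 eq = suc-injective (trans (cong (_+ vertexLabel v) (sym u≡1)) eq)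

        -- Strong induction on `n`. The range is bounded by the number of edges, not by `order`, so
        -- it can pass the largest vertex label.
        adjacentLabel : ∀ n → 2 ≤ n → n ≤ suc size → AdjacentLabel n
        adjacentLabel = <-rec _ λ n rec 2≤n n≤1+q → extend rec n≤1+q (edge-of-sum 2≤n n≤1+q)
          where
          extend : ∀ {n} → (∀ {m} → m < n → 2 ≤ m → m ≤ suc size → AdjacentLabel m) →
                   n ≤ suc size →
                   (∃ λ u → ∃ λ v → Adj u v × vertexLabel u + vertexLabel v ≡ suc n) →
                   AdjacentLabel n
          extend {n} rec n≤1+q (u , v , uv , sum)
            with vertexLabel u ≟ 1 | vertexLabel v ≟ 1
          -- By injectivity of vertex labels, an end labelled 1 is `c` itself.
          ... | yes u≡1 | _ =
            v , subst (λ x → Adj x v) (vertexLabel-injective (trans u≡1 (sym c≡1))) uv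
              , other-end-label u≡1 sum
          ... | no _ | yes v≡1 =
            u , subst (λ x → Adj x u) (vertexLabel-injective (trans v≡1 (sym c≡1))) (Adj-sym uv)
              , other-end-label v≡1 (trans (+-comm (vertexLabel v) _) sum)
          -- Both labels are at least 2 and sum to `n + 1`, so both are below `n`; by induction `c`
          -- is adjacent to both ends.
          ... | no u≢1 | no v≢1 =
            contradiction (Adj-sym (joined v 2≤v v<n)) (triangleFree (joined u 2≤u u<n) uv)
            where
            label≥2 : ∀ {w} → ¬ vertexLabel w ≡ 1 → 2 ≤ vertexLabel w
            label≥2 {w} w≢1 = ≤∧≢⇒< (proj₁ (vertexLabel-bounds w)) (λ eq → w≢1 (sym eq))

            2≤u : 2 ≤ vertexLabel u
            2≤u = label≥2 u≢1

            2≤v : 2 ≤ vertexLabel v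
            2≤v = label≥2 v≢1

            u<n : vertexLabel u < n
            u<n = s≤s⁻¹ (≤-trans (≤-reflexive (+-comm 2 _))
                                 (≤-trans (+-monoʳ-≤ (vertexLabel u) 2≤v) (≤-reflexive sum)))

            v<n : vertexLabel v < n
            v<n = s≤s⁻¹ (≤-trans (+-monoˡ-≤ (vertexLabel v) 2≤u) (≤-reflexive sum))

            joined : ∀ w → 2 ≤ vertexLabel w → vertexLabel w < n → Adj c w
            -- The induction hypothesis yields some neighbour of `c` with the label of `w`;
            -- injectivity identifies it with `w`.
            joined w 2≤w w<n with rec w<n 2≤w (≤-trans (<⇒≤ w<n) n≤1+q)
            ... | x , cx , eq = subst (Adj c) (vertexLabel-injective eq) cx

theorem2p5 : (G : Graph) →
    Graph.size G ≥ Graph.order G →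
    SuperEdgeMagic G →
    (g : ℕ) → Graph.IsGirth G g → g ≥ 4 →
    ¬ (∃ λ (f : SuperEdgeMagicLabeling G) → val G f ≡ 3 + Graph.size G + Graph.order G)
theorem2p5 G q≥p _ g girth g≥4 ((f , super) , valence≡) =
  let p≥1           = IsGirth⇒order>0 G girth
      c , c≡1       = Equivalence.from (super 1) (≤-refl , p≥1)
      -- `order + 1` lies in the range because `size ≥ order`, yet no vertex label exceeds `order`.
      v , _ , v≡1+p = adjacentLabel G f super valence≡ (girth≥4⇒triangleFree G girth g≥4) c≡1
                        (suc (Graph.order G)) (s≤s p≥1) (s≤s q≥p)
  in 1+n≰n (subst (_≤ Graph.order G) v≡1+p (proj₂ (vertexLabel-bounds G f super v)))
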